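{- The function $f_2:\mathbb{N}\to\mathbb{N}$ is strictly increasing, i.e. $f_2(n) < f_2(n+1)$ for every integer $n \geq 1$.
   Context: An oriented graph is a finite directed graph with no loops, no multiple arcs and no directed cycle of length $2$ (i.e. no pair of opposite arcs). The weak diameter of an oriented graph $\overrightarrow{G}$ is the minimum $d$ such that for any two distinct vertices $u,v$ there is a directed path of length at most $d$ from $u$ to $v$ or from $v$ to $u$. For $n\ge 1$, $f_2(n)$ denotes the minimum number of arcs of an oriented graph on $n$ vertices having weak diameter at most $2$. -}

module Defs where

open import Data.Nat using (ℕ; _≤_)
open import Data.Fin using (Fin)
open import Data.Bool using (Bool; true; false; if_then_else_)
open import Data.List using (List; map; allFin)
open import Data.Nat.ListAction using (sum)
open import Data.Product using (Σ; _×_; ∃-syntax)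
open import Data.Sum using (_⊎_)
open import Relation.Binary.PropositionalEquality using (_≡_; _≢_)
open import Relation.Nullary using (¬_)

Digraph : ℕ → Set
Digraph n = Fin n → Fin n → Bool

Arc : ∀ {n} → Digraph n → Fin n → Fin n → Set
Arc A u v = A u v ≡ true

Oriented : ∀ {n} → Digraph n → Set
Oriented {n} A = (∀ u → ¬ Arc A u u) × (∀ u v → ¬ (Arc A u v × Arc A v u))

-- A directed path of length at most 2 from u to v (u ≢ v).  In an oriented
-- graph (no loops) any walk u → w → v with u ≢ v is automatically a path.
Path≤2 : ∀ {n} → Digraph n → Fin n → Fin n → Set
Path≤2 {n} A u v = Arc A u v ⊎ (∃[ w ] (Arc A u w × Arc A w v))

WeakDiam≤2 : ∀ {n} → Digraph n → Set
WeakDiam≤2 {n} A = ∀ (u v : Fin n) → u ≢ v → Path≤2 A u v ⊎ Path≤2 A v u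

arcCount : ∀ {n} → Digraph n → ℕ
arcCount {n} A = sum (map (λ u → sum (map (λ v → if A u v then 1 else 0) (allFin n))) (allFin n))

IsF2 : ℕ → ℕ → Set
IsF2 n m =
  (Σ (Digraph n) λ A → Oriented A × WeakDiam≤2 A × arcCount A ≡ m)
  × (∀ (A : Digraph n) → Oriented A → WeakDiam≤2 A → m ≤ arcCount A)

{-# OPTIONS --safe #-}
-- Two vertices agree at a common neighbour z when both arcs point towards z or both point away
-- from z, and disagree at z when z is the midpoint of a directed 2-path between them.  Take an
-- optimal graph on n + 1 vertices.
--   * If v and w disagree nowhere, identifying them creates no opposite arcs, preserves weak
--     diameter 2 and saves an arc, since v and w are adjacent.
--   * Reversing all arcs at w turns agreement with w into disagreement and conversely.  Hence if
--     v and w agree nowhere, they can be identified after this reversal; only pairs containing w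
--     may lose their 2-path in the reversal, and these disappear.
--   * Otherwise any two vertices both agree and disagree somewhere, so reversing the arcs at any
--     set of vertices preserves weak diameter 2.  Reversing at the in-neighbours of a vertex makes
--     it a source, and a source is never a midpoint, so it can be deleted.
module Submission where

open import Defs
open import Data.Bool using (Bool; true; false; if_then_else_; _∧_; not; _xor_)
import Data.Bool.Properties as Bool
open import Data.Empty using (⊥; ⊥-elim)
open import Data.Fin using (Fin; zero; suc; punchIn; punchOut; _≟_)
open import Data.Fin.Properties using (any?; punchInᵢ≢i; punchIn-injective; punchOut-injective; punchOut-punchIn; punchIn-punchOut; punchOut-cong)
open import Data.List using (map; allFin; tabulate)
open import Data.List.Properties using (map-tabulate)
import Data.Nat.ListAction as ListAction
open import Data.Nat using (ℕ; zero; suc; _+_; _*_; _≤_; _<_; z≤n; s≤s; ⌊_/2⌋)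
open import Data.Nat.Properties using (≤-refl; ≤-reflexive; ≤-trans; ≤-<-trans; m≤m+n; m≤n+m; +-mono-≤; +-mono-<-≤; +-mono-≤-<; +-comm; *-identityˡ; n≡⌊n+n/2⌋; +-*-semiring; module ≤-Reasoning)
open import Data.Product using (Σ; _×_; _,_; ∃; ∃-syntax; proj₁; proj₂; swap)
open import Data.Sum as Sum using (_⊎_; inj₁; inj₂; [_,_]′)
open import Function using (id; _∘_)
open import Relation.Binary.PropositionalEquality using (_≡_; _≢_; refl; sym; trans; cong; cong₂; subst; subst₂; module ≡-Reasoning)
open import Relation.Nullary using (Dec; does; yes; no; ¬_; contradiction)
open import Relation.Nullary.Decidable using (¬?; _×-dec_; _⊎-dec_; dec-true; decidable-stable)
open import Algebra.Properties.Semiring.Sum +-*-semiring using (sum; sum-syntax; sum-cong-≗; sum-replicate-zero; ∑-comm; ∑-distrib-+; *-distribʳ-sum)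

private variable
  m n : ℕ

-- Finite sums and sums over fibres.

sum-mono-≤ : {f g : Fin n → ℕ} → (∀ i → f i ≤ g i) → sum f ≤ sum g
sum-mono-≤ {zero}  f≤g = z≤n
sum-mono-≤ {suc n} f≤g = +-mono-≤ (f≤g zero) (sum-mono-≤ (f≤g ∘ suc))

sum-mono-< : {f g : Fin n → ℕ} → (∀ i → f i ≤ g i) → ∀ k → f k < g k → sum f < sum g
sum-mono-< f≤g zero    f<g = +-mono-<-≤ f<g (sum-mono-≤ (f≤g ∘ suc))
sum-mono-< f≤g (suc k) f<g = +-mono-≤-< (f≤g zero) (sum-mono-< (f≤g ∘ suc) k f<g)

term≤sum : (f : Fin n → ℕ) → ∀ i → f i ≤ sum f
term≤sum f zero    = m≤m+n _ _
term≤sum f (suc i) = ≤-trans (term≤sum (f ∘ suc) i) (m≤n+m _ _)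

δ : Fin n → Fin n → ℕ
δ k i = if does (k ≟ i) then 1 else 0

δ-refl : (i : Fin n) → δ i i ≡ 1
δ-refl i rewrite dec-true (i ≟ i) refl = refl

sum-δ : (k : Fin n) → sum (δ k) ≡ 1
sum-δ {suc n} zero    = cong suc (sum-replicate-zero n)
sum-δ {suc n} (suc k) = sum-δ k

-- The sum of `f` over the fibre of `r` above `i`; writing the fibre with `δ` makes it a full sum,
-- so that sums can be exchanged.
pushforward : (Fin m → Fin n) → (Fin m → ℕ) → Fin n → ℕ
pushforward {m} r f i = ∑[ x < m ] (δ (r x) i * f x)

sum-pushforward : (r : Fin m → Fin n) (f : Fin m → ℕ) → sum (pushforward r f) ≡ sum f
sum-pushforward {m} {n} r f = begin
  ∑[ i < n ] ∑[ x < m ] (δ (r x) i * f x)  ≡⟨ ∑-comm {n} {m} (λ i x → δ (r x) i * f x) ⟩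
  ∑[ x < m ] ∑[ i < n ] (δ (r x) i * f x)  ≡⟨ sum-cong-≗ (λ x → *-distribʳ-sum (f x) (δ (r x))) ⟨
  ∑[ x < m ] (sum (δ (r x)) * f x)         ≡⟨ sum-cong-≗ (λ x → cong (_* f x) (sum-δ (r x))) ⟩
  ∑[ x < m ] (1 * f x)                     ≡⟨ sum-cong-≗ (λ x → *-identityˡ (f x)) ⟩
  sum f                                    ∎
  where open ≡-Reasoning

≤-pushforward : (r : Fin m → Fin n) (f : Fin m → ℕ) → ∀ x → f x ≤ pushforward r f (r x)
≤-pushforward r f x = ≤-trans
  (≤-reflexive (sym (trans (cong (_* f x) (δ-refl (r x))) (*-identityˡ (f x)))))
  (term≤sum (λ x′ → δ (r x′) (r x) * f x′) x)

-- Counting arcs.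

[_] : Bool → ℕ
[ b ] = if b then 1 else 0

sum-tabulate : (f : Fin n → ℕ) → ListAction.sum (tabulate f) ≡ sum f
sum-tabulate {zero}  f = refl
sum-tabulate {suc n} f = cong (f zero +_) (sum-tabulate (f ∘ suc))

sum-allFin : (f : Fin n → ℕ) → ListAction.sum (map f (allFin n)) ≡ sum f
sum-allFin f = trans (cong ListAction.sum (map-tabulate id f)) (sum-tabulate f)

arcCount≡∑∑ : (A : Digraph n) → arcCount A ≡ ∑[ x < n ] ∑[ y < n ] [ A x y ]
arcCount≡∑∑ A = trans (sum-allFin λ x → ListAction.sum (map (λ y → [ A x y ]) (allFin _))) (sum-cong-≗ λ x → sum-allFin (λ y → [ A x y ]))

-- The arcs of `A` are sorted by the images of their ends: each pair `(i , j)` receives the number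
-- of arcs above it, which is at least 1 if `B` has the arc `(i , j)`. The fibres partition all
-- pairs, so these numbers add up to `arcCount A`.
arcCount-image : (r : Fin m → Fin n) (A : Digraph m) (B : Digraph n) →
  (∀ i j → Arc B i j → ∃[ x ] ∃[ y ] (r x ≡ i × r y ≡ j × Arc A x y)) → arcCount B ≤ arcCount A
arcCount-image {m} {n} r A B lift = begin
  arcCount B                               ≡⟨ arcCount≡∑∑ B ⟩
  ∑[ i < n ] ∑[ j < n ] [ B i j ]          ≤⟨ sum-mono-≤ (λ i → sum-mono-≤ (bound i)) ⟩
  ∑[ i < n ] ∑[ j < n ] pushforward r (λ x → g x j) i  ≡⟨ ∑-comm {n} {n} _ ⟩
  ∑[ j < n ] ∑[ i < n ] pushforward r (λ x → g x j) i  ≡⟨ sum-cong-≗ (λ j → sum-pushforward r (λ x → g x j)) ⟩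
  ∑[ j < n ] ∑[ x < m ] g x j              ≡⟨ ∑-comm {n} {m} _ ⟩
  ∑[ x < m ] ∑[ j < n ] g x j              ≡⟨ sum-cong-≗ (λ x → sum-pushforward r (λ y → [ A x y ])) ⟩
  ∑[ x < m ] ∑[ y < m ] [ A x y ]          ≡⟨ arcCount≡∑∑ A ⟨
  arcCount A                               ∎
  where
  open ≤-Reasoning
  g : Fin m → Fin n → ℕ
  g x = pushforward r (λ y → [ A x y ])
  bound : ∀ i j → [ B i j ] ≤ pushforward r (λ x → g x j) i
  bound i j with B i j in eq
  ... | false = z≤n
  ... | true with lift i j eq
  ...   | x , y , refl , refl , a = ≤-trans (≤-reflexive (cong [_] (sym a)))
    (≤-trans (≤-pushforward r (λ y → [ A x y ]) y) (≤-pushforward r (λ x → g x j) x))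

-- Used for strict inequalities: if every arc of `B` still lifts after one arc of `A` is removed,
-- `arcCount-image` gives `arcCount B < arcCount A`.
removeArc : Fin n → Fin n → Digraph n → Digraph n
removeArc u v A x y = A x y ∧ not (does (x ≟ u) ∧ does (y ≟ v))

removeArc⁺ : (A : Digraph n) → ∀ {u v x y} → Arc A x y → x ≢ u ⊎ y ≢ v → Arc (removeArc u v A) x y
removeArc⁺ A {u} {v} {x} {y} a ne rewrite a with x ≟ u | y ≟ v
... | no _    | _       = refl
... | yes _   | no _    = refl
... | yes x≡u | yes y≡v = ⊥-elim ([ (λ x≢u → x≢u x≡u) , (λ y≢v → y≢v y≡v) ]′ ne)

arcCount-removeArc : (A : Digraph n) → ∀ u v → Arc A u v → arcCount (removeArc u v A) < arcCount A
arcCount-removeArc A u v a = subst₂ _<_ (sym (arcCount≡∑∑ (removeArc u v A))) (sym (arcCount≡∑∑ A))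
  (sum-mono-< (λ x → sum-mono-≤ (le x)) u (sum-mono-< (le u) v lt))
  where
  le : ∀ x y → [ removeArc u v A x y ] ≤ [ A x y ]
  le x y with A x y | not (does (x ≟ u) ∧ does (y ≟ v))
  ... | false | _     = z≤n
  ... | true  | false = z≤n
  ... | true  | true  = ≤-refl
  lt : [ removeArc u v A u v ] < [ A u v ]
  lt rewrite a | dec-true (u ≟ u) refl | dec-true (v ≟ v) refl = s≤s z≤n

-- Agreement, disagreement and reversal.

Adjacent : Digraph n → Fin n → Fin n → Set
Adjacent A x y = Arc A x y ⊎ Arc A y x

DisagreeAt AgreeAt : Digraph n → Fin n → Fin n → Fin n → Set
DisagreeAt A x y z = (Arc A x z × Arc A z y) ⊎ (Arc A y z × Arc A z x)
AgreeAt    A x y z = (Arc A x z × Arc A y z) ⊎ (Arc A z x × Arc A z y)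

Disagree Agree : Digraph n → Fin n → Fin n → Set
Disagree A x y = ∃ (DisagreeAt A x y)
Agree    A x y = ∃ (AgreeAt A x y)

-- The condition of `WeakDiam≤2` at one pair. It amounts to being adjacent or disagreeing somewhere,
-- a form symmetric in `x` and `y` whose behaviour under reversal is easy to follow.
Linked : Digraph n → Fin n → Fin n → Set
Linked A x y = Path≤2 A x y ⊎ Path≤2 A y x

Linked⇒ : (A : Digraph n) → ∀ {x y} → Linked A x y → Adjacent A x y ⊎ Disagree A x y
Linked⇒ A (inj₁ (inj₁ a))       = inj₁ (inj₁ a)
Linked⇒ A (inj₁ (inj₂ (z , p))) = inj₂ (z , inj₁ p)
Linked⇒ A (inj₂ (inj₁ a))       = inj₁ (inj₂ a)
Linked⇒ A (inj₂ (inj₂ (z , p))) = inj₂ (z , inj₂ p)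

Adjacent⇒Linked : (A : Digraph n) → ∀ {x y} → Adjacent A x y → Linked A x y
Adjacent⇒Linked A (inj₁ a) = inj₁ (inj₁ a)
Adjacent⇒Linked A (inj₂ a) = inj₂ (inj₁ a)

Disagree⇒Linked : (A : Digraph n) → ∀ {x y} → Disagree A x y → Linked A x y
Disagree⇒Linked A (z , inj₁ p) = inj₁ (inj₂ (z , p))
Disagree⇒Linked A (z , inj₂ p) = inj₂ (inj₂ (z , p))

-- The `xor` reflects that an arc with both ends in the set is reversed twice and so stays as it
-- was.
reverseAt : (Fin n → Bool) → Digraph n → Digraph n
reverseAt s A x y = if s x xor s y then A y x else A x y

module _ (s : Fin n → Bool) (A : Digraph n) where

  reverseAt-oriented : Oriented A → Oriented (reverseAt s A)
  reverseAt-oriented (noLoop , noPair) = loop , pair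
    where
    loop : ∀ u → ¬ Arc (reverseAt s A) u u
    loop u with s u
    ... | true  = noLoop u
    ... | false = noLoop u
    pair : ∀ u v → ¬ (Arc (reverseAt s A) u v × Arc (reverseAt s A) v u)
    pair u v with s u | s v
    ... | true  | true  = noPair u v
    ... | true  | false = noPair u v ∘ swap
    ... | false | true  = noPair u v ∘ swap
    ... | false | false = noPair u v

  arcCount-reverseAt : arcCount (reverseAt s A) ≡ arcCount A
  -- The count is doubled so that `(x , y)` and `(y , x)` can be taken together: reversal at most
  -- exchanges the two terms of `[ A x y ] + [ A y x ]`.
  arcCount-reverseAt = begin
    arcCount (reverseAt s A)                                 ≡⟨ n≡⌊n+n/2⌋ _ ⟩
    ⌊ arcCount (reverseAt s A) + arcCount (reverseAt s A) /2⌋  ≡⟨ cong ⌊_/2⌋ doubled ⟩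
    ⌊ arcCount A + arcCount A /2⌋                             ≡⟨ n≡⌊n+n/2⌋ _ ⟨
    arcCount A                                               ∎
    where
    open ≡-Reasoning
    symmetrised : (B : Digraph n) → arcCount B + arcCount B ≡ ∑[ x < n ] ∑[ y < n ] ([ B x y ] + [ B y x ])
    symmetrised B = begin
      arcCount B + arcCount B
        ≡⟨ cong₂ _+_ (arcCount≡∑∑ B) (trans (arcCount≡∑∑ B) (∑-comm {n} {n} _)) ⟩
      ∑[ x < n ] ∑[ y < n ] [ B x y ] + ∑[ x < n ] ∑[ y < n ] [ B y x ]
        ≡⟨ ∑-distrib-+ (λ x → ∑[ y < n ] [ B x y ]) (λ x → ∑[ y < n ] [ B y x ]) ⟨
      ∑[ x < n ] (∑[ y < n ] [ B x y ] + ∑[ y < n ] [ B y x ])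
        ≡⟨ sum-cong-≗ (λ x → ∑-distrib-+ (λ y → [ B x y ]) (λ y → [ B y x ])) ⟨
      ∑[ x < n ] ∑[ y < n ] ([ B x y ] + [ B y x ]) ∎
    pairwise : ∀ x y → [ reverseAt s A x y ] + [ reverseAt s A y x ] ≡ [ A x y ] + [ A y x ]
    pairwise x y with s x | s y
    ... | true  | true  = refl
    ... | true  | false = +-comm [ A y x ] [ A x y ]
    ... | false | true  = +-comm [ A y x ] [ A x y ]
    ... | false | false = refl
    doubled : arcCount (reverseAt s A) + arcCount (reverseAt s A) ≡ arcCount A + arcCount A
    doubled = trans (symmetrised (reverseAt s A))
      (trans (sum-cong-≗ λ x → sum-cong-≗ (pairwise x)) (sym (symmetrised A)))

  reverseAt-adjacent : ∀ {x y} → Adjacent A x y → Adjacent (reverseAt s A) x y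
  reverseAt-adjacent {x} {y} a with s x | s y
  ... | true  | true  = a
  ... | true  | false = Sum.swap a
  ... | false | true  = Sum.swap a
  ... | false | false = a

  -- With `x` and `y` on the same side, the two arcs at `z` are both kept or both reversed, so the
  -- 2-path survives, possibly in the other direction.
  reverseAt-disagree : ∀ {x y} → s x ≡ s y → Disagree A x y → Disagree (reverseAt s A) x y
  reverseAt-disagree {x} {y} eq (z , d) = z , go d
    where
    go : DisagreeAt A x y z → DisagreeAt (reverseAt s A) x y z
    go d rewrite eq with s y | s z
    ... | true  | true  = d
    ... | true  | false = [ inj₂ ∘ swap , inj₁ ∘ swap ]′ d
    ... | false | true  = [ inj₂ ∘ swap , inj₁ ∘ swap ]′ d
    ... | false | false = d

  -- With `x` and `y` on different sides, exactly one of the two arcs at `z` is reversed. The next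
  -- two lemmas rest on the same fact.
  reverseAt-agree⇒disagree : ∀ {x y} → s x ≢ s y → Agree A x y → Disagree (reverseAt s A) x y
  reverseAt-agree⇒disagree {x} {y} ne (z , d) = z , go d
    where
    go : AgreeAt A x y z → DisagreeAt (reverseAt s A) x y z
    go d with s x | s y | s z
    ... | true  | true  | _     = contradiction refl ne
    ... | false | false | _     = contradiction refl ne
    ... | true  | false | true  = [ inj₁ , inj₂ ∘ swap ]′ d
    ... | true  | false | false = [ inj₂ ∘ swap , inj₁ ]′ d
    ... | false | true  | true  = [ inj₂ ∘ swap , inj₁ ]′ d
    ... | false | true  | false = [ inj₁ , inj₂ ∘ swap ]′ d

  reverseAt-disagree⇒agree : ∀ {x y} → s x ≢ s y → Disagree A x y → Agree (reverseAt s A) x y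
  reverseAt-disagree⇒agree {x} {y} ne (z , d) = z , go d
    where
    go : DisagreeAt A x y z → AgreeAt (reverseAt s A) x y z
    go d with s x | s y | s z
    ... | true  | true  | _     = contradiction refl ne
    ... | false | false | _     = contradiction refl ne
    ... | true  | false | true  = [ inj₁ , inj₂ ∘ swap ]′ d
    ... | true  | false | false = [ inj₂ , inj₁ ∘ swap ]′ d
    ... | false | true  | true  = [ inj₂ , inj₁ ∘ swap ]′ d
    ... | false | true  | false = [ inj₁ , inj₂ ∘ swap ]′ d

  reverseAt-disagree⇒agree⁻ : ∀ {x y} → s x ≢ s y → Disagree (reverseAt s A) x y → Agree A x y
  reverseAt-disagree⇒agree⁻ {x} {y} ne (z , d) = z , go d
    where
    go : DisagreeAt (reverseAt s A) x y z → AgreeAt A x y z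
    go d with s x | s y | s z
    ... | true  | true  | _     = contradiction refl ne
    ... | false | false | _     = contradiction refl ne
    ... | true  | false | true  = [ inj₁ , inj₂ ∘ swap ]′ d
    ... | true  | false | false = [ inj₂ , inj₁ ∘ swap ]′ d
    ... | false | true  | true  = [ inj₂ , inj₁ ∘ swap ]′ d
    ... | false | true  | false = [ inj₁ , inj₂ ∘ swap ]′ d

  reverseAt-linked : ∀ {x y} → s x ≡ s y → Linked A x y → Linked (reverseAt s A) x y
  reverseAt-linked eq l with Linked⇒ A l
  ... | inj₁ a = Adjacent⇒Linked (reverseAt s A) (reverseAt-adjacent a)
  ... | inj₂ d = Disagree⇒Linked (reverseAt s A) (reverseAt-disagree eq d)

-- Identifying two vertices.

Smaller : Digraph m → ℕ → Set
Smaller A n = Σ (Digraph n) λ B → Oriented B × WeakDiam≤2 B × arcCount B < arcCount A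

arc? : (A : Digraph n) → ∀ x y → Dec (Arc A x y)
arc? A x y = A x y Bool.≟ true

does-true⁻ : {P : Set} (p? : Dec P) → does p? ≡ true → P
does-true⁻ (yes p) _ = p

-- The quotient map that glues `w` to `v`; the remaining vertices are renumbered to close the gap
-- left by `w`.
collapse : {v w : Fin (suc n)} → w ≢ v → Fin (suc n) → Fin n
collapse {w = w} w≢v x with w ≟ x
... | yes _  = punchOut w≢v
... | no w≢x = punchOut w≢x

module _ {v w : Fin (suc n)} (w≢v : w ≢ v) where

  collapse-w : collapse w≢v w ≡ punchOut w≢v
  collapse-w with w ≟ w
  ... | yes _  = refl
  ... | no w≢w = contradiction refl w≢w

  collapse-punchOut : ∀ {x} (w≢x : w ≢ x) → collapse w≢v x ≡ punchOut w≢x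
  collapse-punchOut {x} w≢x with w ≟ x
  ... | yes w≡x = contradiction w≡x w≢x
  ... | no _    = punchOut-cong w refl

  collapse-identifies : collapse w≢v v ≡ collapse w≢v w
  collapse-identifies = trans (collapse-punchOut w≢v) (sym collapse-w)

  collapse-punchIn : ∀ i → collapse w≢v (punchIn w i) ≡ i
  collapse-punchIn i = trans (collapse-punchOut (punchInᵢ≢i w i ∘ sym)) (punchOut-punchIn w)

  collapse-kernel : ∀ {x y} → collapse w≢v x ≡ collapse w≢v y → x ≡ y ⊎ (x ≡ v × y ≡ w) ⊎ (x ≡ w × y ≡ v)
  collapse-kernel {x} {y} eq with w ≟ x | w ≟ y
  ... | yes refl | yes refl = inj₁ refl
  ... | yes refl | no w≢y   = inj₂ (inj₂ (refl , sym (punchOut-injective w≢v w≢y eq)))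
  ... | no w≢x   | yes refl = inj₂ (inj₁ (punchOut-injective w≢x w≢v eq , refl))
  ... | no w≢x   | no w≢y   = inj₁ (punchOut-injective w≢x w≢y eq)

module _ {A : Digraph (suc n)} (oriented : Oriented A) {v w : Fin (suc n)} (w≢v : w ≢ v)
         (noDisagree : ¬ Disagree A v w) where

  private
    r = collapse w≢v

    -- The condition `i ≢ j` discards the loop that an arc between `v` and `w` would become, and the
    -- existential merges parallel arcs.
    ImageArc : Fin n → Fin n → Set
    ImageArc i j = i ≢ j × ∃[ x ] ∃[ y ] (r x ≡ i × r y ≡ j × Arc A x y)

    imageArc? : ∀ i j → Dec (ImageArc i j)
    imageArc? i j = ¬? (i ≟ j) ×-dec any? λ x → any? λ y → (r x ≟ i) ×-dec (r y ≟ j) ×-dec arc? A x y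

  identify : Digraph n
  identify i j = does (imageArc? i j)

  private
    arc⁻ : ∀ {i j} → Arc identify i j → ImageArc i j
    arc⁻ {i} {j} = does-true⁻ (imageArc? i j)

    arc⁺ : ∀ {x y} → r x ≢ r y → Arc A x y → Arc identify (r x) (r y)
    arc⁺ {x} {y} ne a = dec-true (imageArc? (r x) (r y)) (ne , x , y , refl , refl , a)

    path⁺ : ∀ {x y} → r x ≢ r y → Path≤2 A x y → Path≤2 identify (r x) (r y)
    path⁺ ne (inj₁ a) = inj₁ (arc⁺ ne a)
    -- If the midpoint is glued to an end of the path, one of the two arcs disappears and the other
    -- alone joins the images.
    path⁺ {x} {y} ne (inj₂ (z , a , b)) with r x ≟ r z | r z ≟ r y
    ... | yes e | _     = inj₁ (subst (λ i → Arc identify i (r y)) (sym e) (arc⁺ (ne ∘ trans e) b))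
    ... | no _  | yes e = inj₁ (subst (Arc identify (r x)) e (arc⁺ (λ e′ → ne (trans e′ e)) a))
    ... | no ne₁ | no ne₂ = inj₂ (r z , arc⁺ ne₁ a , arc⁺ ne₂ b)

  -- Opposite arcs of the quotient lift to `x → y` and `y′ → x′`. If both ends match, `A` has
  -- opposite arcs; if just one matches, it is the midpoint of a 2-path between `v` and `w`; if
  -- neither does, the arc `x → y` is a loop or lies inside the glued pair.
  identify-oriented : Oriented identify
  identify-oriented = (λ u e → proj₁ (arc⁻ e) refl) , λ u v (e , e′) → noPair (arc⁻ e) (arc⁻ e′)
    where
    noPair : ∀ {i j} → ImageArc i j → ImageArc j i → ⊥
    noPair (i≢j , x , y , refl , refl , a) (_ , y′ , x′ , ey , ex , b)
      with collapse-kernel w≢v ex | collapse-kernel w≢v ey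
    ... | inj₁ refl                 | inj₁ refl                 = proj₂ oriented x y (a , b)
    ... | inj₁ refl                 | inj₂ (inj₁ (refl , refl)) = noDisagree (x , inj₁ (b , a))
    ... | inj₁ refl                 | inj₂ (inj₂ (refl , refl)) = noDisagree (x , inj₂ (b , a))
    ... | inj₂ (inj₁ (refl , refl)) | inj₁ refl                 = noDisagree (y , inj₂ (a , b))
    ... | inj₂ (inj₂ (refl , refl)) | inj₁ refl                 = noDisagree (y , inj₁ (a , b))
    ... | inj₂ (inj₁ (refl , refl)) | inj₂ (inj₁ (refl , refl)) = proj₁ oriented w a
    ... | inj₂ (inj₁ (refl , refl)) | inj₂ (inj₂ (refl , refl)) = i≢j (sym (collapse-identifies w≢v))
    ... | inj₂ (inj₂ (refl , refl)) | inj₂ (inj₁ (refl , refl)) = i≢j (collapse-identifies w≢v)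
    ... | inj₂ (inj₂ (refl , refl)) | inj₂ (inj₂ (refl , refl)) = proj₁ oriented v a

  -- Every vertex of the quotient has a representative other than `w`, so links between such
  -- vertices suffice. This leaves room for a graph reversed at `w`.
  identify-weakDiam : (∀ x y → x ≢ w → y ≢ w → x ≢ y → Linked A x y) → WeakDiam≤2 identify
  identify-weakDiam linked i j i≢j
    with linked (punchIn w i) (punchIn w j) (punchInᵢ≢i w i) (punchInᵢ≢i w j) (i≢j ∘ punchIn-injective w i j)
  ... | inj₁ p = inj₁ (subst₂ (Path≤2 identify) (collapse-punchIn w≢v i) (collapse-punchIn w≢v j)
    (path⁺ (λ e → i≢j (subst₂ _≡_ (collapse-punchIn w≢v i) (collapse-punchIn w≢v j) e)) p))
  ... | inj₂ p = inj₂ (subst₂ (Path≤2 identify) (collapse-punchIn w≢v j) (collapse-punchIn w≢v i)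
    (path⁺ (λ e → i≢j (sym (subst₂ _≡_ (collapse-punchIn w≢v j) (collapse-punchIn w≢v i) e))) p))

  private
    -- An arc that becomes a loop or that acquires a parallel arc is saved.
    saves : ∀ u z → Arc A u z →
      (∀ i j → ImageArc i j → ∃[ x ] ∃[ y ] (r x ≡ i × r y ≡ j × Arc (removeArc u z A) x y)) →
      arcCount identify < arcCount A
    saves u z a lift = ≤-<-trans
      (arcCount-image r (removeArc u z A) identify (λ i j → lift i j ∘ arc⁻))
      (arcCount-removeArc A u z a)

    loop : ∀ u z → r u ≡ r z → Arc A u z → arcCount identify < arcCount A
    loop u z e a = saves u z a lift
      where
      lift : ∀ i j → ImageArc i j → ∃[ x ] ∃[ y ] (r x ≡ i × r y ≡ j × Arc (removeArc u z A) x y)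
      lift _ _ (i≢j , x , y , refl , refl , b) with x ≟ u
      ... | no x≢u   = x , y , refl , refl , removeArc⁺ A b (inj₁ x≢u)
      ... | yes refl = x , y , refl , refl , removeArc⁺ A b (inj₂ λ { refl → i≢j e })

    parallel : ∀ u z u′ z′ → r u′ ≡ r u → r z′ ≡ r z → u′ ≢ u ⊎ z′ ≢ z → Arc A u z → Arc A u′ z′ →
      arcCount identify < arcCount A
    parallel u z u′ z′ eu ez ne a a′ = saves u z a lift
      where
      lift : ∀ i j → ImageArc i j → ∃[ x ] ∃[ y ] (r x ≡ i × r y ≡ j × Arc (removeArc u z A) x y)
      lift _ _ (i≢j , x , y , refl , refl , b) with x ≟ u | y ≟ z
      ... | no x≢u   | _        = x , y , refl , refl , removeArc⁺ A b (inj₁ x≢u)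
      ... | yes _    | no y≢z   = x , y , refl , refl , removeArc⁺ A b (inj₂ y≢z)
      -- The image of the removed arc is still covered by its parallel copy.
      ... | yes refl | yes refl = u′ , z′ , eu , ez , removeArc⁺ A a′ ne

  identify-arcCount : Adjacent A v w ⊎ Agree A v w → arcCount identify < arcCount A
  identify-arcCount (inj₁ (inj₁ a)) = loop v w (collapse-identifies w≢v) a
  identify-arcCount (inj₁ (inj₂ a)) = loop w v (sym (collapse-identifies w≢v)) a
  identify-arcCount (inj₂ (z , inj₁ (a , b))) = parallel w z v z (collapse-identifies w≢v) refl (inj₁ (w≢v ∘ sym)) b a
  identify-arcCount (inj₂ (z , inj₂ (a , b))) = parallel z w z v refl (collapse-identifies w≢v) (inj₂ (w≢v ∘ sym)) b a

  identify-smaller : (∀ x y → x ≢ w → y ≢ w → x ≢ y → Linked A x y) →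
    Adjacent A v w ⊎ Agree A v w → Smaller A n
  identify-smaller linked saved =
    identify , identify-oriented , identify-weakDiam linked , identify-arcCount saved

-- Pairs without disagreement or without agreement.

smaller-noDisagree : (A : Digraph (suc n)) → Oriented A → WeakDiam≤2 A →
  ∀ {v w} → w ≢ v → ¬ Disagree A v w → Smaller A n
smaller-noDisagree A oriented linked {v} {w} w≢v ¬d with Linked⇒ A (linked v w (w≢v ∘ sym))
... | inj₁ a = identify-smaller oriented w≢v ¬d (λ x y _ _ → linked x y) (inj₁ a)
... | inj₂ d = contradiction d ¬d

smaller-noAgree : (A : Digraph (suc n)) → Oriented A → WeakDiam≤2 A →
  ∀ {v w} → w ≢ v → ¬ Agree A v w → Smaller A n
smaller-noAgree {n} A oriented linked {v} {w} w≢v ¬a =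
  let B , or , wd , lt = identify-smaller (reverseAt-oriented s A oriented) w≢v
        (¬a ∘ reverseAt-disagree⇒agree⁻ s A sv≢sw) linked′ saved
  in B , or , wd , subst (arcCount B <_) (arcCount-reverseAt s A) lt
  where
  s : Fin (suc n) → Bool
  s x = does (x ≟ w)
  s-false : ∀ {x} → x ≢ w → s x ≡ false
  s-false {x} x≢w with x ≟ w
  ... | yes e = contradiction e x≢w
  ... | no _  = refl
  sv≢sw : s v ≢ s w
  sv≢sw e with trans (sym (s-false (w≢v ∘ sym))) (trans e (dec-true (w ≟ w) refl))
  ... | ()
  linked′ : ∀ x y → x ≢ w → y ≢ w → x ≢ y → Linked (reverseAt s A) x y
  linked′ x y x≢w y≢w x≢y =
    reverseAt-linked s A (trans (s-false x≢w) (sym (s-false y≢w))) (linked x y x≢y)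
  -- If `v` and `w` were linked by a 2-path, its two arcs agree after the reversal and become
  -- parallel under the identification.
  saved : Adjacent (reverseAt s A) v w ⊎ Agree (reverseAt s A) v w
  saved with Linked⇒ A (linked v w (w≢v ∘ sym))
  ... | inj₁ a = inj₁ (reverseAt-adjacent s A a)
  ... | inj₂ d = inj₂ (reverseAt-disagree⇒agree s A sv≢sw d)

-- Deleting a source.

delete : Fin (suc n) → Digraph (suc n) → Digraph n
delete v A i j = A (punchIn v i) (punchIn v j)

delete-source-smaller : (A : Digraph (suc n)) → Oriented A → WeakDiam≤2 A →
  ∀ v → (∀ x → ¬ Arc A x v) → ∀ {w} → v ≢ w → Smaller A n
delete-source-smaller {n} A (noLoop , noPair) linked v source {w} v≢w =
  delete v A , ((λ i → noLoop _) , (λ i j → noPair _ _)) , weakDiam , fewer outArc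
  where
  path : ∀ {i j} → Path≤2 A (punchIn v i) (punchIn v j) → Path≤2 (delete v A) i j
  path (inj₁ a) = inj₁ a
  path {i} {j} (inj₂ (z , a , b)) with v ≟ z
  ... | yes refl = contradiction a (source _)
  ... | no v≢z   = inj₂ (punchOut v≢z ,
    subst (Arc A (punchIn v i)) (sym (punchIn-punchOut v≢z)) a ,
    subst (λ z → Arc A z (punchIn v j)) (sym (punchIn-punchOut v≢z)) b)

  weakDiam : WeakDiam≤2 (delete v A)
  weakDiam i j i≢j = Sum.map path path (linked _ _ (i≢j ∘ punchIn-injective v i j))

  -- A link between the source and the other vertex `w` can only start at the source, which provides
  -- an arc lost in the deletion.
  outArc : ∃ (Arc A v)
  outArc with linked v w v≢w
  ... | inj₁ (inj₁ a)           = _ , a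
  ... | inj₁ (inj₂ (z , a , _)) = _ , a
  ... | inj₂ (inj₁ a)           = contradiction a (source _)
  ... | inj₂ (inj₂ (_ , _ , a)) = contradiction a (source _)

  fewer : ∃ (Arc A v) → arcCount (delete v A) < arcCount A
  fewer (z , a) = ≤-<-trans
    -- Here `collapse` serves as a left inverse of `punchIn v`; where it sends `v` itself does not
    -- affect the lifts.
    (arcCount-image (collapse v≢w) (removeArc v z A) (delete v A) λ i j b →
      punchIn v i , punchIn v j , collapse-punchIn v≢w i , collapse-punchIn v≢w j ,
      removeArc⁺ A b (inj₁ (punchInᵢ≢i v i)))
    (arcCount-removeArc A v z a)

smaller-allDisagreeAgree : (A : Digraph (suc n)) → Oriented A →
  (∀ x y → x ≢ y → Disagree A x y × Agree A x y) → ∀ {v w : Fin (suc n)} → v ≢ w → Smaller A n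
smaller-allDisagreeAgree {n} A oriented both {v} v≢w =
  let B , or , wd , lt = delete-source-smaller (reverseAt s A) (reverseAt-oriented s A oriented) linked v source v≢w
  in B , or , wd , subst (arcCount B <_) (arcCount-reverseAt s A) lt
  where
  s : Fin (suc n) → Bool
  -- The in-neighbours of `v`. As `A` has no loops, `v` is not among them, so every arc into `v` is
  -- turned around.
  s x = A x v
  source : ∀ x → ¬ Arc (reverseAt s A) x v
  source x e with A v v in vv | A x v in xv
  ... | true  | _     = proj₁ oriented v vv
  ... | false | true  = proj₂ oriented x v (xv , e)
  source x () | false | false
  linked : WeakDiam≤2 (reverseAt s A)
  linked x y x≢y with s x Bool.≟ s y
  ... | yes e = Disagree⇒Linked (reverseAt s A) (reverseAt-disagree s A e (proj₁ (both x y x≢y)))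
  ... | no ne = Disagree⇒Linked (reverseAt s A) (reverseAt-agree⇒disagree s A ne (proj₂ (both x y x≢y)))

-- Case distinction and conclusion.

disagree? : (A : Digraph n) → ∀ x y → Dec (Disagree A x y)
disagree? A x y = any? λ z → (arc? A x z ×-dec arc? A z y) ⊎-dec (arc? A y z ×-dec arc? A z x)

agree? : (A : Digraph n) → ∀ x y → Dec (Agree A x y)
agree? A x y = any? λ z → (arc? A x z ×-dec arc? A y z) ⊎-dec (arc? A z x ×-dec arc? A z y)

smaller : (A : Digraph (suc (suc n))) → Oriented A → WeakDiam≤2 A → Smaller A (suc n)
smaller A oriented linked
  with any? (λ v → any? λ w → ¬? (w ≟ v) ×-dec (¬? (disagree? A v w) ⊎-dec ¬? (agree? A v w)))
... | yes (v , w , w≢v , inj₁ ¬d) = smaller-noDisagree A oriented linked w≢v ¬d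
... | yes (v , w , w≢v , inj₂ ¬a) = smaller-noAgree A oriented linked w≢v ¬a
-- Any two distinct vertices do: the first becomes the source, the second ensures that it has an
-- out-arc. Hence the order `suc (suc n)`.
... | no none = smaller-allDisagreeAgree A oriented both {zero} {suc zero} λ ()
  where
  both : ∀ x y → x ≢ y → Disagree A x y × Agree A x y
  both x y x≢y =
    decidable-stable (disagree? A x y) (λ ¬d → none (x , y , x≢y ∘ sym , inj₁ ¬d)) ,
    decidable-stable (agree? A x y) (λ ¬a → none (x , y , x≢y ∘ sym , inj₂ ¬a))

theorem5 : ∀ (n : ℕ) → 1 ≤ n → ∀ (a b : ℕ) → IsF2 n a → IsF2 (suc n) b → a < b
theorem5 (suc n) _ a b (_ , minimal) ((A , oriented , linked , refl) , _) =
  -- With `A` optimal, so that `b` is `arcCount A`, the chain is `a ≤ arcCount B < arcCount A`.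
  let B , oriented′ , linked′ , fewer = smaller A oriented linked
  in ≤-<-trans (minimal B oriented′ linked′) fewer
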